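{- The following identities hold: \begin{align*} \sum_{k=0}^\infty\frac{(22k^2+17k-2)\binom{4k}k}{(k+1)16^k}&=17, \\\sum_{k=0}^\infty\frac{(11k^2+8k+1)\binom{4k}k}{(3k+1)(3k+2)16^k}&=1, \\\sum_{k=0}^\infty\frac{(22k^2-18k+3)\binom{4k}k}{(2k-1)(4k-1)(4k-3)16^k}&=-\frac13. \end{align*} -}

module Defs where

open import Data.Nat.Base as ℕ using (ℕ; zero; suc)
import Data.Nat.Properties as ℕ
open import Data.Integer.Base as ℤ
  using (ℤ; +_; _+_; _-_; _*_; _^_; NonZero)
import Data.Integer.Properties as ℤ
open import Data.Product.Base using (∃-syntax)
open import Data.Rational.Base as ℚ using (ℚ; 0ℚ)
open import Data.Rational.Literals using (fromℤ)
open import Relation.Binary.PropositionalEquality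
  using (_≡_; sym; trans; cong)
open import Relation.Nullary.Negation.Core using (contradiction)

infixl 7 _÷_

_÷_ : (i j : ℤ) → .{{_ : NonZero j}} → ℚ
i ÷ j = fromℤ i ℚ.÷ fromℤ j

partialSum : (ℕ → ℚ) → ℕ → ℚ
partialSum a zero    = 0ℚ
partialSum a (suc n) = partialSum a n ℚ.+ a n

-- The terms and values of the series are rational, so convergence with
-- respect to rational ε is the same as convergence in ℝ.
_ConvergesTo_ : (ℕ → ℚ) → ℚ → Set
s ConvergesTo L =
  ∀ (ε : ℚ) → 0ℚ ℚ.< ε → ∃[ N ] ∀ n → N ℕ.≤ n → ℚ.∣ s n ℚ.- L ∣ ℚ.< ε

infix 4 _ConvergesTo_ _HasSum_

_HasSum_ : (ℕ → ℚ) → ℚ → Set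
a HasSum L = partialSum a ConvergesTo L

private
  16^≢0 : ∀ k → NonZero ((+ 16) ^ k)
  16^≢0 k = ℤ.≢-nonZero λ eq → contradiction (ℤ.i^n≡0⇒i≡0 (+ 16) k eq) λ ()

  k+1≢0 : ∀ k → NonZero (+ k + + 1)
  k+1≢0 k rewrite ℕ.+-suc k 0 = _

  ck+d≢0 : ∀ c k d → NonZero (+ c * + k + + suc d)
  ck+d≢0 c k d rewrite sym (ℤ.pos-* c k) | ℕ.+-suc (c ℕ.* k) d = _

  even-odd≢0 : ∀ i m n → i ≡ + (2 ℕ.* m) → NonZero (i - + suc (2 ℕ.* n))
  even-odd≢0 i m n i≡2m = ℤ.≢-nonZero λ eq →
    ℕ.even≢odd m n (ℤ.+-injective
      (trans (sym i≡2m) (ℤ.i-j≡0⇒i≡j i (+ suc (2 ℕ.* n)) eq)))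

  4k≡2[2k] : ∀ k → + 4 * + k ≡ + (2 ℕ.* (2 ℕ.* k))
  4k≡2[2k] k = trans (sym (ℤ.pos-* 4 k)) (cong +_ (ℕ.*-assoc 2 2 k))

  2k-1≢0 : ∀ k → NonZero (+ 2 * + k - + 1)
  2k-1≢0 k = even-odd≢0 (+ 2 * + k) k 0 (sym (ℤ.pos-* 2 k))

  4k-1≢0 : ∀ k → NonZero (+ 4 * + k - + 1)
  4k-1≢0 k = even-odd≢0 (+ 4 * + k) (2 ℕ.* k) 0 (4k≡2[2k] k)

  4k-3≢0 : ∀ k → NonZero (+ 4 * + k - + 3)
  4k-3≢0 k = even-odd≢0 (+ 4 * + k) (2 ℕ.* k) 1 (4k≡2[2k] k)

  times : ∀ i j → NonZero i → NonZero j → NonZero (i * j)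
  times i j i≢0 j≢0 = ℤ.i*j≢0 i j {{i≢0}} {{j≢0}}

denominator₁≢0 : ∀ k → NonZero ((+ k + + 1) * (+ 16) ^ k)
denominator₁≢0 k = times (+ k + + 1) ((+ 16) ^ k) (k+1≢0 k) (16^≢0 k)

denominator₂≢0 : ∀ k →
  NonZero ((+ 3 * + k + + 1) * (+ 3 * + k + + 2) * (+ 16) ^ k)
denominator₂≢0 k =
  times (3k+1 * 3k+2) ((+ 16) ^ k)
    (times 3k+1 3k+2 (ck+d≢0 3 k 0) (ck+d≢0 3 k 1))
    (16^≢0 k)
  where
  3k+1 = + 3 * + k + + 1
  3k+2 = + 3 * + k + + 2

denominator₃≢0 : ∀ k →
  NonZero ((+ 2 * + k - + 1) * (+ 4 * + k - + 1) * (+ 4 * + k - + 3) * (+ 16) ^ k)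
denominator₃≢0 k =
  times (2k-1 * 4k-1 * 4k-3) ((+ 16) ^ k)
    (times (2k-1 * 4k-1) 4k-3
      (times 2k-1 4k-1 (2k-1≢0 k) (4k-1≢0 k)) (4k-3≢0 k))
    (16^≢0 k)
  where
  2k-1 = + 2 * + k - + 1
  4k-1 = + 4 * + k - + 1
  4k-3 = + 4 * + k - + 3

{-# OPTIONS --safe #-}

-- Let V n = Σ_{i ≤ n} C(4n, i).  Pascal's rule gives
-- Σ_{i ≤ n} C(M + 1, i) = 2 Σ_{i ≤ n} C(M, i) - C(M, n), so V (n + 1) - 16 V n is
-- a rational function of n times C(4n, n).  Each series telescopes once a multiple
-- of V n is admitted: for suitable constants, α V n + (β + γ n) C(4n, n) over c 16^n
-- has the terms of the series as its differences (for the third series, the terms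
-- with index shifted by one).  From 2^M Σ_{i ≤ m} C(M, i) ≤ 3^M 2^m we get
-- V n ≤ (81/8)^n, so these remainders tend to 0.

module Submission where

open import Data.Nat.Base as ℕ using (ℕ; zero; suc; s≤s; _!)
import Data.Nat.Properties as ℕ
open import Data.Nat.Combinatorics
  using (_C_; nCk≡n!/k![n-k]!; k![n∸k]!∣n!; nCk+nC[k+1]≡[n+1]C[k+1])
open import Data.Nat.DivMod using (m/n*n≡m)
import Data.Nat.Tactic.RingSolver as ℕ-Ring
open import Data.Integer.Base as ℤ
  using (ℤ; +_; -[1+_]; +[1+_]; +0; -1ℤ; _+_; _-_; _*_; _^_; -_; ∣_∣)
import Data.Integer.Properties as ℤ
import Data.Integer.Tactic.RingSolver as ℤ-Ring
open import Data.Product.Base using (_×_; _,_; ∃-syntax)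
open import Data.Rational.Base as ℚ using (ℚ; mkℚ; 0ℚ; *<*)
open import Data.Rational.Literals using (fromℤ)
import Data.Rational.Properties as ℚ
import Data.Rational.Solver as ℚ-Solver
import Data.Rational.Unnormalised.Base as ℚᵘ
import Data.Rational.Unnormalised.Properties as ℚᵘ
open import Function.Base using (it)
open import Relation.Binary.PropositionalEquality
open import Defs

-- Recurrences for binomial coefficients

nCk*k!*[n∸k]!≡n! : ∀ {n k} → k ℕ.≤ n → (n C k) ℕ.* (k ! ℕ.* (n ℕ.∸ k) !) ≡ n !
nCk*k!*[n∸k]!≡n! {n} {k} k≤n = begin
  (n C k) ℕ.* d    ≡⟨ cong (ℕ._* d) (nCk≡n!/k![n-k]! k≤n) ⟩
  (n ! ℕ./ d) ℕ.* d ≡⟨ m/n*n≡m (k![n∸k]!∣n! k≤n) ⟩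
  n !              ∎
  where
  open ≡-Reasoning
  d = k ! ℕ.* (n ℕ.∸ k) !
  instance _ = k ℕ.!* (n ℕ.∸ k) !≢0

[j+m]Cm*m!*j!≡[j+m]! : ∀ j m → ((j ℕ.+ m) C m) ℕ.* (m ! ℕ.* j !) ≡ (j ℕ.+ m) !
[j+m]Cm*m!*j!≡[j+m]! j m = begin
  ((j ℕ.+ m) C m) ℕ.* (m ! ℕ.* j !)
    ≡⟨ cong (λ i → ((j ℕ.+ m) C m) ℕ.* (m ! ℕ.* i !)) (ℕ.m+n∸n≡m j m) ⟨
  ((j ℕ.+ m) C m) ℕ.* (m ! ℕ.* (j ℕ.+ m ℕ.∸ m) !)
    ≡⟨ nCk*k!*[n∸k]!≡n! (ℕ.m≤n+m m j) ⟩
  (j ℕ.+ m) !  ∎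
  where open ≡-Reasoning

-- Multiplied by `m ! * j !`, both sides become `(1 + j + m) !`. Writing the upper index as `j + m`
-- avoids truncated subtraction.
[1+j]*[1+j+m]Cm≡[1+j+m]*[j+m]Cm : ∀ j m → suc j ℕ.* (suc (j ℕ.+ m) C m) ≡ suc (j ℕ.+ m) ℕ.* ((j ℕ.+ m) C m)
[1+j]*[1+j+m]Cm≡[1+j+m]*[j+m]Cm j m = ℕ.*-cancelʳ-≡ _ _ d {{m ℕ.!* j !≢0}} (begin
  suc j ℕ.* (suc (j ℕ.+ m) C m) ℕ.* d
    ≡⟨ rearrange (suc j) (suc (j ℕ.+ m) C m) (m !) (j !) ⟩
  (suc (j ℕ.+ m) C m) ℕ.* (m ! ℕ.* suc j !)
    ≡⟨ [j+m]Cm*m!*j!≡[j+m]! (suc j) m ⟩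
  suc (j ℕ.+ m) ℕ.* (j ℕ.+ m) !
    ≡⟨ cong (suc (j ℕ.+ m) ℕ.*_) ([j+m]Cm*m!*j!≡[j+m]! j m) ⟨
  suc (j ℕ.+ m) ℕ.* (((j ℕ.+ m) C m) ℕ.* d)
    ≡⟨ ℕ.*-assoc (suc (j ℕ.+ m)) ((j ℕ.+ m) C m) d ⟨
  suc (j ℕ.+ m) ℕ.* ((j ℕ.+ m) C m) ℕ.* d ∎)
  where
  open ≡-Reasoning
  d = m ! ℕ.* j !
  rearrange : ∀ a b c e → a ℕ.* b ℕ.* (c ℕ.* e) ≡ b ℕ.* (c ℕ.* (a ℕ.* e))
  rearrange = ℕ-Ring.solve-∀

[1+m]*[1+j+m]C[1+m]≡[1+j+m]*[j+m]Cm : ∀ j m → suc m ℕ.* (suc (j ℕ.+ m) C suc m) ≡ suc (j ℕ.+ m) ℕ.* ((j ℕ.+ m) C m)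
[1+m]*[1+j+m]C[1+m]≡[1+j+m]*[j+m]Cm j m = ℕ.*-cancelʳ-≡ _ _ d {{m ℕ.!* j !≢0}} (begin
  suc m ℕ.* (suc (j ℕ.+ m) C suc m) ℕ.* d
    ≡⟨ rearrange (suc m) (suc (j ℕ.+ m) C suc m) (m !) (j !) ⟩
  (suc (j ℕ.+ m) C suc m) ℕ.* (suc m ! ℕ.* j !)
    ≡⟨ subst (λ k → (k C suc m) ℕ.* (suc m ! ℕ.* j !) ≡ k !) (ℕ.+-suc j m) ([j+m]Cm*m!*j!≡[j+m]! j (suc m)) ⟩
  suc (j ℕ.+ m) ℕ.* (j ℕ.+ m) !
    ≡⟨ cong (suc (j ℕ.+ m) ℕ.*_) ([j+m]Cm*m!*j!≡[j+m]! j m) ⟨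
  suc (j ℕ.+ m) ℕ.* (((j ℕ.+ m) C m) ℕ.* d)
    ≡⟨ ℕ.*-assoc (suc (j ℕ.+ m)) ((j ℕ.+ m) C m) d ⟨
  suc (j ℕ.+ m) ℕ.* ((j ℕ.+ m) C m) ℕ.* d ∎)
  where
  open ≡-Reasoning
  d = m ! ℕ.* j !
  rearrange : ∀ a b c e → a ℕ.* b ℕ.* (c ℕ.* e) ≡ b ℕ.* (a ℕ.* c ℕ.* e)
  rearrange = ℕ-Ring.solve-∀

-- Partial row sums of Pascal's triangle

^-distribʳ-* : ∀ a b n → (a ℕ.* b) ℕ.^ n ≡ a ℕ.^ n ℕ.* b ℕ.^ n
^-distribʳ-* a b zero    = refl
^-distribʳ-* a b (suc n) = begin
  a ℕ.* b ℕ.* (a ℕ.* b) ℕ.^ n          ≡⟨ cong (a ℕ.* b ℕ.*_) (^-distribʳ-* a b n) ⟩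
  a ℕ.* b ℕ.* (a ℕ.^ n ℕ.* b ℕ.^ n)    ≡⟨ interchange a b (a ℕ.^ n) (b ℕ.^ n) ⟩
  a ℕ.* a ℕ.^ n ℕ.* (b ℕ.* b ℕ.^ n)    ∎
  where
  open ≡-Reasoning
  interchange : ∀ a b c d → a ℕ.* b ℕ.* (c ℕ.* d) ≡ a ℕ.* c ℕ.* (b ℕ.* d)
  interchange = ℕ-Ring.solve-∀

rowSum : ℕ → ℕ → ℕ
rowSum M zero    = 1
rowSum M (suc m) = rowSum M m ℕ.+ M C suc m

C≤rowSum : ∀ M m → M C m ℕ.≤ rowSum M m
C≤rowSum M zero    = ℕ.≤-refl
C≤rowSum M (suc m) = ℕ.m≤n+m (M C suc m) (rowSum M m)

-- By Pascal's rule each `M C i` with `i < m` enters row `M + 1` twice and `M C m` only once; adding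
-- `M C m` evens this out.
rowSum-suc : ∀ M m → rowSum (suc M) m ℕ.+ M C m ≡ 2 ℕ.* rowSum M m
rowSum-suc M zero    = refl
rowSum-suc M (suc m) = begin
  rowSum (suc M) m ℕ.+ suc M C suc m ℕ.+ M C suc m
    ≡⟨ cong (λ c → rowSum (suc M) m ℕ.+ c ℕ.+ M C suc m) (nCk+nC[k+1]≡[n+1]C[k+1] M m) ⟨
  rowSum (suc M) m ℕ.+ (M C m ℕ.+ M C suc m) ℕ.+ M C suc m
    ≡⟨ regroup (rowSum (suc M) m) (M C m) (M C suc m) ⟩
  rowSum (suc M) m ℕ.+ M C m ℕ.+ 2 ℕ.* (M C suc m)
    ≡⟨ cong (ℕ._+ 2 ℕ.* (M C suc m)) (rowSum-suc M m) ⟩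
  2 ℕ.* rowSum M m ℕ.+ 2 ℕ.* (M C suc m)
    ≡⟨ ℕ.*-distribˡ-+ 2 (rowSum M m) (M C suc m) ⟨
  2 ℕ.* (rowSum M m ℕ.+ M C suc m) ∎
  where
  open ≡-Reasoning
  regroup : ∀ r a b → r ℕ.+ (a ℕ.+ b) ℕ.+ b ≡ r ℕ.+ a ℕ.+ 2 ℕ.* b
  regroup = ℕ-Ring.solve-∀

rowSum-pascal : ∀ M m → rowSum (suc M) (suc m) ≡ rowSum M (suc m) ℕ.+ rowSum M m
rowSum-pascal M m = begin
  rowSum (suc M) m ℕ.+ suc M C suc m
    ≡⟨ cong (rowSum (suc M) m ℕ.+_) (nCk+nC[k+1]≡[n+1]C[k+1] M m) ⟨
  rowSum (suc M) m ℕ.+ (M C m ℕ.+ M C suc m)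
    ≡⟨ ℕ.+-assoc (rowSum (suc M) m) (M C m) (M C suc m) ⟨
  rowSum (suc M) m ℕ.+ M C m ℕ.+ M C suc m
    ≡⟨ cong (ℕ._+ M C suc m) (rowSum-suc M m) ⟩
  2 ℕ.* rowSum M m ℕ.+ M C suc m
    ≡⟨ regroup (rowSum M m) (M C suc m) ⟩
  rowSum M m ℕ.+ M C suc m ℕ.+ rowSum M m ∎
  where
  open ≡-Reasoning
  regroup : ∀ r b → 2 ℕ.* r ℕ.+ b ≡ r ℕ.+ b ℕ.+ r
  regroup = ℕ-Ring.solve-∀

-- The function `(3/2)^M * 2^m` satisfies the recurrence `rowSum-pascal` exactly and dominates
-- `rowSum` on both boundaries.
rowSum-bound : ∀ M m → 2 ℕ.^ M ℕ.* rowSum M m ℕ.≤ 3 ℕ.^ M ℕ.* 2 ℕ.^ m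
rowSum-bound M zero = ℕ.*-monoˡ-≤ 1 (ℕ.^-monoˡ-≤ M (ℕ.n≤1+n 2))
rowSum-bound zero (suc m) = ℕ.*-monoʳ-≤ 1 (begin
  rowSum 0 (suc m) ≡⟨ rowSum-zero (suc m) ⟩
  1                ≤⟨ ℕ.m^n>0 2 (suc m) ⟩
  2 ℕ.^ suc m      ∎)
  where
  open ℕ.≤-Reasoning
  rowSum-zero : ∀ m → rowSum 0 m ≡ 1
  rowSum-zero zero    = refl
  rowSum-zero (suc m) = trans (ℕ.+-identityʳ (rowSum 0 m)) (rowSum-zero m)
rowSum-bound (suc M) (suc m) = begin
  2 ℕ.* 2^M ℕ.* rowSum (suc M) (suc m)
    ≡⟨ cong (2 ℕ.* 2^M ℕ.*_) (rowSum-pascal M m) ⟩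
  2 ℕ.* 2^M ℕ.* (rowSum M (suc m) ℕ.+ rowSum M m)
    ≡⟨ distribute 2^M (rowSum M (suc m)) (rowSum M m) ⟩
  2 ℕ.* (2^M ℕ.* rowSum M (suc m) ℕ.+ 2^M ℕ.* rowSum M m)
    ≤⟨ ℕ.*-monoʳ-≤ 2 (ℕ.+-mono-≤ (rowSum-bound M (suc m)) (rowSum-bound M m)) ⟩
  2 ℕ.* (3^M ℕ.* (2 ℕ.* 2 ℕ.^ m) ℕ.+ 3^M ℕ.* 2 ℕ.^ m)
    ≡⟨ collect 3^M (2 ℕ.^ m) ⟩
  3 ℕ.* 3^M ℕ.* (2 ℕ.* 2 ℕ.^ m) ∎
  where
  open ℕ.≤-Reasoning
  2^M = 2 ℕ.^ M
  3^M = 3 ℕ.^ M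
  distribute : ∀ a b c → 2 ℕ.* a ℕ.* (b ℕ.+ c) ≡ 2 ℕ.* (a ℕ.* b ℕ.+ a ℕ.* c)
  distribute = ℕ-Ring.solve-∀
  collect : ∀ a b → 2 ℕ.* (a ℕ.* (2 ℕ.* b) ℕ.+ a ℕ.* b) ≡ 3 ℕ.* a ℕ.* (2 ℕ.* b)
  collect = ℕ-Ring.solve-∀

-- Decay of the quarter row sums relative to powers of 16

-- The `V n` of the introduction.
quarterSum : ℕ → ℕ
quarterSum n = rowSum (4 ℕ.* n) n

16^n*quarterSum≤162^n : ∀ n → 16 ℕ.^ n ℕ.* quarterSum n ℕ.≤ 162 ℕ.^ n
16^n*quarterSum≤162^n n = begin
  16 ℕ.^ n ℕ.* quarterSum n          ≡⟨ cong (ℕ._* quarterSum n) (ℕ.^-*-assoc 2 4 n) ⟩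
  2 ℕ.^ (4 ℕ.* n) ℕ.* quarterSum n   ≤⟨ rowSum-bound (4 ℕ.* n) n ⟩
  3 ℕ.^ (4 ℕ.* n) ℕ.* 2 ℕ.^ n ≡⟨ cong (ℕ._* 2 ℕ.^ n) (ℕ.^-*-assoc 3 4 n) ⟨
  81 ℕ.^ n ℕ.* 2 ℕ.^ n       ≡⟨ ^-distribʳ-* 81 2 n ⟨
  162 ℕ.^ n ∎
  where open ℕ.≤-Reasoning

-- The induction step for the next bound. The shift 4 is the least for which it already holds at
-- `n = 0`, where the margin is 46.
162*[5+n]²≤256*[4+n]² : ∀ n → (5 ℕ.+ n) ℕ.* (5 ℕ.+ n) ℕ.* 162 ℕ.≤ (4 ℕ.+ n) ℕ.* (4 ℕ.+ n) ℕ.* 256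
162*[5+n]²≤256*[4+n]² n = begin
  lhs         ≤⟨ ℕ.m≤m+n lhs slack ⟩
  lhs ℕ.+ slack ≡⟨ compare n ⟩
  (4 ℕ.+ n) ℕ.* (4 ℕ.+ n) ℕ.* 256 ∎
  where
  open ℕ.≤-Reasoning
  lhs = (5 ℕ.+ n) ℕ.* (5 ℕ.+ n) ℕ.* 162
  slack = 94 ℕ.* (n ℕ.* n) ℕ.+ 428 ℕ.* n ℕ.+ 46
  compare : ∀ n → (5 ℕ.+ n) ℕ.* (5 ℕ.+ n) ℕ.* 162 ℕ.+ (94 ℕ.* (n ℕ.* n) ℕ.+ 428 ℕ.* n ℕ.+ 46)
                ≡ (4 ℕ.+ n) ℕ.* (4 ℕ.+ n) ℕ.* 256
  compare = ℕ-Ring.solve-∀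

[4+n]²*162^n≤16*256^n : ∀ n → (4 ℕ.+ n) ℕ.* (4 ℕ.+ n) ℕ.* 162 ℕ.^ n ℕ.≤ 16 ℕ.* 256 ℕ.^ n
[4+n]²*162^n≤16*256^n zero    = ℕ.≤-refl
[4+n]²*162^n≤16*256^n (suc n) =
  step ((4 ℕ.+ n) ℕ.* (4 ℕ.+ n)) ((5 ℕ.+ n) ℕ.* (5 ℕ.+ n)) 162 256 (162 ℕ.^ n) (256 ℕ.^ n)
    (162*[5+n]²≤256*[4+n]² n) ([4+n]²*162^n≤16*256^n n)
  where
  open ℕ.≤-Reasoning
  regroup : ∀ a b c → a ℕ.* (b ℕ.* c) ≡ b ℕ.* (a ℕ.* c)
  regroup = ℕ-Ring.solve-∀
  regroup′ : ∀ a b c → a ℕ.* b ℕ.* c ≡ b ℕ.* (a ℕ.* c)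
  regroup′ = ℕ-Ring.solve-∀
  step : ∀ s t a b x y → t ℕ.* a ℕ.≤ s ℕ.* b → s ℕ.* x ℕ.≤ 16 ℕ.* y →
         t ℕ.* (a ℕ.* x) ℕ.≤ 16 ℕ.* (b ℕ.* y)
  step s t a b x y ta≤sb sx≤16y = begin
    t ℕ.* (a ℕ.* x)     ≡⟨ ℕ.*-assoc t a x ⟨
    t ℕ.* a ℕ.* x       ≤⟨ ℕ.*-monoˡ-≤ x ta≤sb ⟩
    s ℕ.* b ℕ.* x       ≡⟨ regroup′ s b x ⟩
    b ℕ.* (s ℕ.* x)     ≤⟨ ℕ.*-monoʳ-≤ b sx≤16y ⟩
    b ℕ.* (16 ℕ.* y)    ≡⟨ regroup b 16 y ⟩
    16 ℕ.* (b ℕ.* y)    ∎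

-- Quadratic decay of `V n / 16^n` is all that is extracted from the geometric bound: one factor
-- `4 + n` will absorb the linear coefficient of `C(4n, n)` in the remainders, the other makes them
-- vanish.
quarterSum-bound : ∀ n → (4 ℕ.+ n) ℕ.* (4 ℕ.+ n) ℕ.* quarterSum n ℕ.≤ 16 ℕ.* 16 ℕ.^ n
quarterSum-bound n = ℕ.*-cancelʳ-≤ _ _ (16 ℕ.^ n) {{ℕ.m^n≢0 16 n}} (begin
  s ℕ.* quarterSum n ℕ.* 16 ℕ.^ n          ≡⟨ regroup s (quarterSum n) (16 ℕ.^ n) ⟩
  s ℕ.* (16 ℕ.^ n ℕ.* quarterSum n)        ≤⟨ ℕ.*-monoʳ-≤ s (16^n*quarterSum≤162^n n) ⟩
  s ℕ.* 162 ℕ.^ n                 ≤⟨ [4+n]²*162^n≤16*256^n n ⟩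
  16 ℕ.* 256 ℕ.^ n                ≡⟨ cong (16 ℕ.*_) (^-distribʳ-* 16 16 n) ⟩
  16 ℕ.* (16 ℕ.^ n ℕ.* 16 ℕ.^ n)  ≡⟨ ℕ.*-assoc 16 (16 ℕ.^ n) (16 ℕ.^ n) ⟨
  16 ℕ.* 16 ℕ.^ n ℕ.* 16 ℕ.^ n    ∎)
  where
  open ℕ.≤-Reasoning
  s = (4 ℕ.+ n) ℕ.* (4 ℕ.+ n)
  regroup : ∀ a b c → a ℕ.* b ℕ.* c ≡ a ℕ.* (c ℕ.* b)
  regroup = ℕ-Ring.solve-∀

-- Arithmetic of integer fractions

fromℤ-homo-+ : ∀ i j → fromℤ (i + j) ≡ fromℤ i ℚ.+ fromℤ j
fromℤ-homo-+ i j = ℚ.toℚᵘ-injective (ℚᵘ.≃-trans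
  (ℚᵘ.*≡* (cong (_* + 1) (sym (cong₂ _+_ (ℤ.*-identityʳ i) (ℤ.*-identityʳ j)))))
  (ℚᵘ.≃-sym (ℚ.toℚᵘ-homo-+ (fromℤ i) (fromℤ j))))

fromℤ-homo-* : ∀ i j → fromℤ (i * j) ≡ fromℤ i ℚ.* fromℤ j
fromℤ-homo-* i j = ℚ.toℚᵘ-injective (ℚᵘ.≃-sym (ℚ.toℚᵘ-homo-* (fromℤ i) (fromℤ j)))

*-cancelʳ-≡ : ∀ p q r .{{_ : ℚ.NonZero r}} → p ℚ.* r ≡ q ℚ.* r → p ≡ q
*-cancelʳ-≡ p q r pr≡qr = trans (sym (undo p)) (trans (cong (ℚ._* ℚ.1/ r) pr≡qr) (undo q))
  where
  undo : ∀ x → x ℚ.* r ℚ.* ℚ.1/ r ≡ x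
  undo x = trans (ℚ.*-assoc x r (ℚ.1/ r))
    (trans (cong (x ℚ.*_) (ℚ.*-inverseʳ r)) (ℚ.*-identityʳ x))

÷-*-cancel : ∀ i j .{{_ : ℤ.NonZero j}} → (i ÷ j) ℚ.* fromℤ j ≡ fromℤ i
÷-*-cancel i j = trans (ℚ.*-assoc (fromℤ i) (ℚ.1/ fromℤ j) (fromℤ j))
  (trans (cong (fromℤ i ℚ.*_) (ℚ.*-inverseˡ (fromℤ j))) (ℚ.*-identityʳ (fromℤ i)))

-- Multiplication by the nonzero `j * l * o` clears all three quotients, so an identity of fractions
-- reduces to one over the integers.
÷-+ : ∀ i j k l m o .{{_ : ℤ.NonZero j}} .{{_ : ℤ.NonZero l}} .{{_ : ℤ.NonZero o}} →
      (i * l + k * j) * o ≡ m * (j * l) → (i ÷ j) ℚ.+ (k ÷ l) ≡ m ÷ o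
÷-+ i j k l m o eq =
  *-cancelʳ-≡ _ _ (fromℤ (j * l * o)) {{ℤ.i*j≢0 (j * l) o {{ℤ.i*j≢0 j l}}}} (begin
    (x ℚ.+ y) ℚ.* fromℤ (j * l * o)
      ≡⟨ cong ((x ℚ.+ y) ℚ.*_) (fromℤ-*₃ j l o) ⟩
    (x ℚ.+ y) ℚ.* (fromℤ j ℚ.* fromℤ l ℚ.* fromℤ o)
      ≡⟨ expand x y (fromℤ j) (fromℤ l) (fromℤ o) ⟩
    (x ℚ.* fromℤ j ℚ.* fromℤ l ℚ.+ y ℚ.* fromℤ l ℚ.* fromℤ j) ℚ.* fromℤ o
      ≡⟨ cong₂ (λ p q → (p ℚ.* fromℤ l ℚ.+ q ℚ.* fromℤ j) ℚ.* fromℤ o) (÷-*-cancel i j) (÷-*-cancel k l) ⟩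
    (fromℤ i ℚ.* fromℤ l ℚ.+ fromℤ k ℚ.* fromℤ j) ℚ.* fromℤ o
      ≡⟨ cong (ℚ._* fromℤ o) (cong₂ ℚ._+_ (fromℤ-homo-* i l) (fromℤ-homo-* k j)) ⟨
    (fromℤ (i * l) ℚ.+ fromℤ (k * j)) ℚ.* fromℤ o
      ≡⟨ cong (ℚ._* fromℤ o) (fromℤ-homo-+ (i * l) (k * j)) ⟨
    fromℤ (i * l + k * j) ℚ.* fromℤ o
      ≡⟨ fromℤ-homo-* (i * l + k * j) o ⟨
    fromℤ ((i * l + k * j) * o)
      ≡⟨ cong fromℤ eq ⟩
    fromℤ (m * (j * l))
      ≡⟨ fromℤ-homo-* m (j * l) ⟩
    fromℤ m ℚ.* fromℤ (j * l)
      ≡⟨ cong₂ ℚ._*_ (sym (÷-*-cancel m o)) (fromℤ-homo-* j l) ⟩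
    z ℚ.* fromℤ o ℚ.* (fromℤ j ℚ.* fromℤ l)
      ≡⟨ collect z (fromℤ j) (fromℤ l) (fromℤ o) ⟩
    z ℚ.* (fromℤ j ℚ.* fromℤ l ℚ.* fromℤ o)
      ≡⟨ cong (z ℚ.*_) (fromℤ-*₃ j l o) ⟨
    z ℚ.* fromℤ (j * l * o) ∎)
  where
  open ≡-Reasoning
  open ℚ-Solver.+-*-Solver
  x = i ÷ j
  y = k ÷ l
  z = m ÷ o
  fromℤ-*₃ : ∀ a b c → fromℤ (a * b * c) ≡ fromℤ a ℚ.* fromℤ b ℚ.* fromℤ c
  fromℤ-*₃ a b c = trans (fromℤ-homo-* (a * b) c) (cong (ℚ._* fromℤ c) (fromℤ-homo-* a b))
  expand : ∀ x y a b c → (x ℚ.+ y) ℚ.* (a ℚ.* b ℚ.* c) ≡ (x ℚ.* a ℚ.* b ℚ.+ y ℚ.* b ℚ.* a) ℚ.* c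
  expand = solve 5 (λ x y a b c → (x :+ y) :* (a :* b :* c) := (x :* a :* b :+ y :* b :* a) :* c) refl
  collect : ∀ z a b c → z ℚ.* c ℚ.* (a ℚ.* b) ≡ z ℚ.* (a ℚ.* b ℚ.* c)
  collect = solve 4 (λ z a b c → z :* c :* (a :* b) := z :* (a :* b :* c)) refl

-- Convergence and telescoping

-- A positive `ε` with denominator `q` has numerator at least 1, hence is at least `1 / q`; the
-- hypothesis puts the fraction below `1 / q`.
∣÷∣-bound : ∀ i j .{{_ : ℤ.NonZero j}} ε → 0ℚ ℚ.< ε →
            ∣ i ∣ ℕ.* ℚ.↧ₙ ε ℕ.< ∣ j ∣ → ℚ.∣ i ÷ j ∣ ℚ.< ε
∣÷∣-bound i j (mkℚ +0 _ _) (*<* (ℤ.+<+ ()))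
∣÷∣-bound i j (mkℚ -[1+ _ ] _ _) (*<* ())
∣÷∣-bound i j ε@(mkℚ +[1+ p ] q-1 _) _ iq<j =
  ℚ.*-cancelʳ-<-nonNeg (fromℤ (+ ∣ j ∣)) (begin-strict
    ℚ.∣ i ÷ j ∣ ℚ.* fromℤ (+ ∣ j ∣)  ≡⟨ ℚ.∣p*q∣≡∣p∣*∣q∣ (i ÷ j) (fromℤ j) ⟨
    ℚ.∣ (i ÷ j) ℚ.* fromℤ j ∣        ≡⟨ cong ℚ.∣_∣ (÷-*-cancel i j) ⟩
    fromℤ (+ ∣ i ∣)                  <⟨ i<εj ⟩
    ε ℚ.* fromℤ (+ ∣ j ∣)            ∎)
  where
  open ℚ.≤-Reasoning
  -- The factors 1 are the denominators of the embedded integers in the cross-multiplied form of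
  -- `<`.
  iq<[1+p]j : ∣ i ∣ ℕ.* (suc q-1 ℕ.* 1) ℕ.< suc p ℕ.* ∣ j ∣ ℕ.* 1
  iq<[1+p]j = subst₂ ℕ._<_
    (cong (∣ i ∣ ℕ.*_) (sym (ℕ.*-identityʳ (suc q-1))))
    (sym (ℕ.*-identityʳ (suc p ℕ.* ∣ j ∣)))
    (ℕ.<-≤-trans iq<j (ℕ.m≤m+n ∣ j ∣ (p ℕ.* ∣ j ∣)))
  i<εj : fromℤ (+ ∣ i ∣) ℚ.< ε ℚ.* fromℤ (+ ∣ j ∣)
  i<εj = ℚ.toℚᵘ-cancel-< (ℚᵘ.<-respʳ-≃ (ℚᵘ.≃-sym (ℚ.toℚᵘ-homo-* ε (fromℤ (+ ∣ j ∣))))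
    (ℚᵘ.*<* (subst₂ ℤ._<_ (ℤ.pos-* ∣ i ∣ _)
      (trans (ℤ.pos-* (suc p ℕ.* ∣ j ∣) 1) (cong (_* + 1) (ℤ.pos-* (suc p) ∣ j ∣)))
      (ℤ.+<+ iq<[1+p]j))))

-- The bound says that the fraction is at most `K / (n + 1)`, which is below `1 / q` once `n`
-- reaches `K * q`.
÷-converges-0 : ∀ (u v : ℕ → ℤ) (v≢0 : ∀ n → ℤ.NonZero (v n)) K →
                (∀ n → suc n ℕ.* ∣ u n ∣ ℕ.≤ K ℕ.* ∣ v n ∣) →
                ∀ ε → 0ℚ ℚ.< ε → ∃[ N ] ∀ n → N ℕ.≤ n → ℚ.∣ (u n ÷ v n) {{v≢0 n}} ∣ ℚ.< ε
÷-converges-0 u v v≢0 K bound ε 0<ε = K ℕ.* q , λ n Kq≤n →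
  ∣÷∣-bound (u n) (v n) {{v≢0 n}} ε 0<ε (ℕ.*-cancelˡ-< (suc n) _ _ (begin-strict
    suc n ℕ.* (∣ u n ∣ ℕ.* q)    ≡⟨ ℕ.*-assoc (suc n) ∣ u n ∣ q ⟨
    suc n ℕ.* ∣ u n ∣ ℕ.* q      ≤⟨ ℕ.*-monoˡ-≤ q (bound n) ⟩
    K ℕ.* ∣ v n ∣ ℕ.* q          ≡⟨ swap K ∣ v n ∣ q ⟩
    K ℕ.* q ℕ.* ∣ v n ∣          ≤⟨ ℕ.*-monoˡ-≤ ∣ v n ∣ Kq≤n ⟩
    n ℕ.* ∣ v n ∣                <⟨ ℕ.*-monoˡ-< ∣ v n ∣ {{v≢0 n}} (ℕ.n<1+n n) ⟩
    suc n ℕ.* ∣ v n ∣            ∎))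
  where
  open ℕ.≤-Reasoning
  q = ℚ.↧ₙ ε
  swap : ∀ a b c → a ℕ.* b ℕ.* c ≡ a ℕ.* c ℕ.* b
  swap = ℕ-Ring.solve-∀

-- The initial value `- L` fixes the additive constant of the antidifference `g`, making it the
-- signed error itself; summing to `L` then amounts to `g` tending to 0.
partialSum-telescope : ∀ (a : ℕ → ℚ) L (g : ℕ → ℚ) → g 0 ≡ ℚ.- L → (∀ n → g n ℚ.+ a n ≡ g (suc n)) →
                       ∀ n → partialSum a n ℚ.- L ≡ g n
partialSum-telescope a L g g0 step zero    = trans (ℚ.+-identityˡ (ℚ.- L)) (sym g0)
partialSum-telescope a L g g0 step (suc n) = begin
  partialSum a n ℚ.+ a n ℚ.- L    ≡⟨ swap (partialSum a n) (a n) (ℚ.- L) ⟩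
  partialSum a n ℚ.- L ℚ.+ a n    ≡⟨ cong (ℚ._+ a n) (partialSum-telescope a L g g0 step n) ⟩
  g n ℚ.+ a n                     ≡⟨ step n ⟩
  g (suc n)                       ∎
  where
  open ≡-Reasoning
  open ℚ-Solver.+-*-Solver
  swap : ∀ x y z → x ℚ.+ y ℚ.+ z ≡ x ℚ.+ z ℚ.+ y
  swap = solve 3 (λ x y z → x :+ y :+ z := x :+ z :+ y) refl

hasSum-telescope : ∀ (a : ℕ → ℚ) L (u v : ℕ → ℤ) (v≢0 : ∀ n → ℤ.NonZero (v n)) →
  let g n = (u n ÷ v n) {{v≢0 n}} in
  g 0 ≡ ℚ.- L → (∀ n → g n ℚ.+ a n ≡ g (suc n)) →
  ∀ K → (∀ n → suc n ℕ.* ∣ u n ∣ ℕ.≤ K ℕ.* ∣ v n ∣) → a HasSum L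
hasSum-telescope a L u v v≢0 g0 step K bound ε 0<ε =
  let N , close = ÷-converges-0 u v v≢0 K bound ε 0<ε in
  N , λ n N≤n → subst (λ x → ℚ.∣ x ∣ ℚ.< ε)
    (sym (partialSum-telescope a L (λ n → (u n ÷ v n) {{v≢0 n}}) g0 step n)) (close n N≤n)

partialSum-suc : ∀ a n → partialSum a (suc n) ≡ a 0 ℚ.+ partialSum (λ k → a (suc k)) n
partialSum-suc a zero    = ℚ.+-comm 0ℚ (a 0)
partialSum-suc a (suc n) = trans (cong (ℚ._+ a (suc n)) (partialSum-suc a n))
  (ℚ.+-assoc (a 0) (partialSum (λ k → a (suc k)) n) (a (suc n)))

-- Used for the third series, which is telescoped from index 1. The threshold `suc N` excludes the
-- empty partial sum.
hasSum-suc : ∀ a L → (λ k → a (suc k)) HasSum L → a HasSum (a 0 ℚ.+ L)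
hasSum-suc a L tail ε 0<ε with tail ε 0<ε
... | N , close = suc N , λ { (suc n) (s≤s N≤n) →
  subst (λ x → ℚ.∣ x ∣ ℚ.< ε) (sym (shift n)) (close n N≤n) }
  where
  open ℚ-Solver.+-*-Solver
  cancel : ∀ x y z → x ℚ.+ y ℚ.- (x ℚ.+ z) ≡ y ℚ.- z
  cancel = solve 3 (λ x y z → x :+ y :- (x :+ z) := y :- z) refl
  shift : ∀ n → partialSum a (suc n) ℚ.- (a 0 ℚ.+ L) ≡ partialSum (λ k → a (suc k)) n ℚ.- L
  shift n = trans (cong (ℚ._- (a 0 ℚ.+ L)) (partialSum-suc a n))
    (cancel (a 0) (partialSum (λ k → a (suc k)) n) L)

-- Passing from row 4n to row 4(n + 1)

pos-affine : ∀ a d n → + (suc d ℕ.+ a ℕ.* n) ≡ + a * + n + + suc d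
pos-affine a d n = trans (cong +_ (ℕ.+-comm (suc d) (a ℕ.* n))) (cong (_+ + suc d) (ℤ.pos-* a n))

affine≢0 : ∀ a d n → ℤ.NonZero (+ a * + n + + suc d)
affine≢0 a d n = subst ℤ.NonZero (pos-affine a d n) _

-- The index `i` walks from row `4n` to row `4n + 4`, the row belonging to `n + 1`. Integer values
-- permit subtraction in the recurrences.
rowCoeff rowTotal : ℕ → ℕ → ℤ
rowCoeff i n = + ((i ℕ.+ 4 ℕ.* n) C n)
rowTotal i n = + rowSum (i ℕ.+ 4 ℕ.* n) n

rowCoeff-suc : ∀ i n → (+ 3 * + n + + suc i) * rowCoeff (suc i) n ≡ (+ 4 * + n + + suc i) * rowCoeff i n
rowCoeff-suc i n = begin
  (+ 3 * + n + + suc i) * rowCoeff (suc i) n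
    ≡⟨ cong (_* rowCoeff (suc i) n) (pos-affine 3 i n) ⟨
  + (suc i ℕ.+ 3 ℕ.* n) * rowCoeff (suc i) n
    ≡⟨ ℤ.pos-* (suc i ℕ.+ 3 ℕ.* n) (suc (i ℕ.+ 4 ℕ.* n) C n) ⟨
  + (suc (i ℕ.+ 3 ℕ.* n) ℕ.* (suc (i ℕ.+ 4 ℕ.* n) C n))
    ≡⟨ cong +_ (subst (λ M → suc (i ℕ.+ 3 ℕ.* n) ℕ.* (suc M C n) ≡ suc M ℕ.* (M C n))
         (split i n) ([1+j]*[1+j+m]Cm≡[1+j+m]*[j+m]Cm (i ℕ.+ 3 ℕ.* n) n)) ⟩
  + (suc (i ℕ.+ 4 ℕ.* n) ℕ.* ((i ℕ.+ 4 ℕ.* n) C n))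
    ≡⟨ ℤ.pos-* (suc i ℕ.+ 4 ℕ.* n) ((i ℕ.+ 4 ℕ.* n) C n) ⟩
  + (suc i ℕ.+ 4 ℕ.* n) * rowCoeff i n
    ≡⟨ cong (_* rowCoeff i n) (pos-affine 4 i n) ⟩
  (+ 4 * + n + + suc i) * rowCoeff i n ∎
  where
  open ≡-Reasoning
  split : ∀ i n → i ℕ.+ 3 ℕ.* n ℕ.+ n ≡ i ℕ.+ 4 ℕ.* n
  split = ℕ-Ring.solve-∀

-- The last of the four row steps, in which the column rises from `n` to `n + 1` as well.
rowCoeff-wrap : ∀ n → (+ n + + 1) * rowCoeff 0 (suc n) ≡ (+ 4 * + n + + 4) * rowCoeff 3 n
rowCoeff-wrap n = begin
  (+ n + + 1) * rowCoeff 0 (suc n)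
    ≡⟨ cong (λ k → + k * rowCoeff 0 (suc n)) (ℕ.+-comm n 1) ⟩
  + suc n * rowCoeff 0 (suc n)
    ≡⟨ cong (λ M → + suc n * + (M C suc n)) (ℕ.*-suc 4 n) ⟩
  + suc n * + ((4 ℕ.+ 4 ℕ.* n) C suc n)
    ≡⟨ ℤ.pos-* (suc n) ((4 ℕ.+ 4 ℕ.* n) C suc n) ⟨
  + (suc n ℕ.* ((4 ℕ.+ 4 ℕ.* n) C suc n))
    ≡⟨ cong +_ (subst (λ M → suc n ℕ.* (suc M C suc n) ≡ suc M ℕ.* (M C n))
         (split n) ([1+m]*[1+j+m]C[1+m]≡[1+j+m]*[j+m]Cm (3 ℕ.+ 3 ℕ.* n) n)) ⟩
  + ((4 ℕ.+ 4 ℕ.* n) ℕ.* ((3 ℕ.+ 4 ℕ.* n) C n))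
    ≡⟨ ℤ.pos-* (4 ℕ.+ 4 ℕ.* n) ((3 ℕ.+ 4 ℕ.* n) C n) ⟩
  + (4 ℕ.+ 4 ℕ.* n) * rowCoeff 3 n
    ≡⟨ cong (_* rowCoeff 3 n) (pos-affine 4 3 n) ⟩
  (+ 4 * + n + + 4) * rowCoeff 3 n ∎
  where
  open ≡-Reasoning
  split : ∀ n → 3 ℕ.+ 3 ℕ.* n ℕ.+ n ≡ 3 ℕ.+ 4 ℕ.* n
  split = ℕ-Ring.solve-∀

rowTotal-suc : ∀ i n → rowTotal (suc i) n ≡ + 2 * rowTotal i n - rowCoeff i n
rowTotal-suc i n = begin
  rowTotal (suc i) n
    ≡⟨ add-sub (rowTotal (suc i) n) (rowCoeff i n) ⟩
  rowTotal (suc i) n + rowCoeff i n - rowCoeff i n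
    ≡⟨ cong (_- rowCoeff i n) (trans (cong +_ (rowSum-suc (i ℕ.+ 4 ℕ.* n) n)) (ℤ.pos-* 2 (rowSum (i ℕ.+ 4 ℕ.* n) n))) ⟩
  + 2 * rowTotal i n - rowCoeff i n ∎
  where
  open ≡-Reasoning
  add-sub : ∀ x y → x ≡ x + y - y
  add-sub = ℤ-Ring.solve-∀

rowTotal-wrap : ∀ n → rowTotal 0 (suc n) ≡ rowTotal 4 n + rowCoeff 0 (suc n)
rowTotal-wrap n = cong (λ M → + (rowSum M n ℕ.+ (4 ℕ.* suc n) C suc n)) (ℕ.*-suc 4 n)

-- `P₃ n` is `(3n+3)! / (3n)!` and `P₄ n` is `(4n+3)! / (4n)!`, so that
-- `C(4n+3, n) = (P₄ n / P₃ n) C(4n, n)`.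
P₃ P₄ : ℤ → ℤ
P₃ n = (+ 3 * n + + 1) * (+ 3 * n + + 2) * (+ 3 * n + + 3)
P₄ n = (+ 4 * n + + 1) * (+ 4 * n + + 2) * (+ 4 * n + + 3)

P₃≢0 : ∀ n → ℤ.NonZero (P₃ (+ n))
P₃≢0 n = ℤ.i*j≢0 (p₁ * p₂) p₃ {{ℤ.i*j≢0 p₁ p₂ {{affine≢0 3 0 n}} {{affine≢0 3 1 n}}}} {{affine≢0 3 2 n}}
  where
  p₁ = + 3 * + n + + 1
  p₂ = + 3 * + n + + 2
  p₃ = + 3 * + n + + 3

module _ (n : ℕ) where
  open ≡-Reasoning

  private
    x = + n
    p₁ = + 3 * x + + 1
    p₂ = + 3 * x + + 2
    p₃ = + 3 * x + + 3
    q₁ = + 4 * x + + 1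
    q₂ = + 4 * x + + 2
    q₃ = + 4 * x + + 3
    c = λ i → rowCoeff i n

  -- With the common denominator `P₃ x` cleared, this and the next three lemmas express every
  -- coefficient met on the way as a polynomial multiple of `C(4n, n)`.
  scaled₁ : P₃ x * c 1 ≡ q₁ * p₂ * p₃ * c 0
  scaled₁ = begin
    p₁ * p₂ * p₃ * c 1     ≡⟨ pull p₁ p₂ p₃ (c 1) ⟩
    p₂ * p₃ * (p₁ * c 1)   ≡⟨ cong (p₂ * p₃ *_) (rowCoeff-suc 0 n) ⟩
    p₂ * p₃ * (q₁ * c 0)   ≡⟨ pull q₁ p₂ p₃ (c 0) ⟨
    q₁ * p₂ * p₃ * c 0     ∎
    where
    pull : ∀ a b d e → a * b * d * e ≡ b * d * (a * e)
    pull = ℤ-Ring.solve-∀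

  scaled₂ : P₃ x * c 2 ≡ q₁ * q₂ * p₃ * c 0
  scaled₂ = begin
    p₁ * p₂ * p₃ * c 2     ≡⟨ pull p₁ p₂ p₃ (c 2) ⟩
    p₁ * p₃ * (p₂ * c 2)   ≡⟨ cong (p₁ * p₃ *_) (rowCoeff-suc 1 n) ⟩
    p₁ * p₃ * (q₂ * c 1)   ≡⟨ pull₂ p₁ p₃ q₂ (c 1) ⟩
    q₂ * p₃ * (p₁ * c 1)   ≡⟨ cong (q₂ * p₃ *_) (rowCoeff-suc 0 n) ⟩
    q₂ * p₃ * (q₁ * c 0)   ≡⟨ pull₃ q₁ q₂ p₃ (c 0) ⟩
    q₁ * q₂ * p₃ * c 0     ∎
    where
    pull : ∀ a b d e → a * b * d * e ≡ a * d * (b * e)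
    pull = ℤ-Ring.solve-∀
    pull₂ : ∀ a b d e → a * b * (d * e) ≡ d * b * (a * e)
    pull₂ = ℤ-Ring.solve-∀
    pull₃ : ∀ a b d e → b * d * (a * e) ≡ a * b * d * e
    pull₃ = ℤ-Ring.solve-∀

  scaled₃ : P₃ x * c 3 ≡ P₄ x * c 0
  -- The extra `p₃` is needed to apply `rowCoeff-suc` to `c 3` while keeping the whole of `P₃ x` for
  -- `scaled₂`.
  scaled₃ = ℤ.*-cancelˡ-≡ p₃ _ _ {{affine≢0 3 2 n}} (begin
    p₃ * (p₁ * p₂ * p₃ * c 3)     ≡⟨ pull p₁ p₂ p₃ (c 3) ⟩
    p₁ * p₂ * p₃ * (p₃ * c 3)     ≡⟨ cong (P₃ x *_) (rowCoeff-suc 2 n) ⟩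
    p₁ * p₂ * p₃ * (q₃ * c 2)     ≡⟨ pull₂ (P₃ x) q₃ (c 2) ⟩
    q₃ * (p₁ * p₂ * p₃ * c 2)     ≡⟨ cong (q₃ *_) scaled₂ ⟩
    q₃ * (q₁ * q₂ * p₃ * c 0)     ≡⟨ pull₃ q₁ q₂ q₃ p₃ (c 0) ⟩
    p₃ * (q₁ * q₂ * q₃ * c 0)     ∎)
    where
    pull : ∀ a b d e → d * (a * b * d * e) ≡ a * b * d * (d * e)
    pull = ℤ-Ring.solve-∀
    pull₂ : ∀ a b d → a * (b * d) ≡ b * (a * d)
    pull₂ = ℤ-Ring.solve-∀
    pull₃ : ∀ a b d f e → d * (a * b * f * e) ≡ f * (a * b * d * e)
    pull₃ = ℤ-Ring.solve-∀

  scaled-wrap : P₃ x * rowCoeff 0 (suc n) ≡ + 4 * P₄ x * c 0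
  scaled-wrap = begin
    -- The factor `3x + 3` of `P₃ x` is `3 (x + 1)`, which supplies the `x + 1` of `rowCoeff-wrap`.
    P₃ x * c′                              ≡⟨ pull x c′ ⟩
    + 3 * p₁ * p₂ * ((x + + 1) * c′)      ≡⟨ cong (+ 3 * p₁ * p₂ *_) (rowCoeff-wrap n) ⟩
    + 3 * p₁ * p₂ * ((+ 4 * x + + 4) * c 3) ≡⟨ pull₂ x (c 3) ⟩
    + 4 * (P₃ x * c 3)                     ≡⟨ cong (+ 4 *_) scaled₃ ⟩
    + 4 * (P₄ x * c 0)                     ≡⟨ ℤ.*-assoc (+ 4) (P₄ x) (c 0) ⟨
    + 4 * P₄ x * c 0                       ∎
    where
    c′ = rowCoeff 0 (suc n)
    pull : ∀ x e → (+ 3 * x + + 1) * (+ 3 * x + + 2) * (+ 3 * x + + 3) * e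
                 ≡ + 3 * (+ 3 * x + + 1) * (+ 3 * x + + 2) * ((x + + 1) * e)
    pull = ℤ-Ring.solve-∀
    pull₂ : ∀ x e → + 3 * (+ 3 * x + + 1) * (+ 3 * x + + 2) * ((+ 4 * x + + 4) * e)
                  ≡ + 4 * ((+ 3 * x + + 1) * (+ 3 * x + + 2) * (+ 3 * x + + 3) * e)
    pull₂ = ℤ-Ring.solve-∀

  -- Four row steps double the sum four times, giving 16; the coefficient subtracted at step `i` is
  -- doubled in the remaining `3 - i` steps.
  rowTotal-step : rowTotal 0 (suc n) ≡
    + 16 * rowTotal 0 n + (rowCoeff 0 (suc n) - + 8 * c 0 - + 4 * c 1 - + 2 * c 2 - c 3)
  rowTotal-step = begin
    rowTotal 0 (suc n)         ≡⟨ rowTotal-wrap n ⟩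
    rowTotal 4 n + c′          ≡⟨ cong (_+ c′) (rowTotal-suc 3 n) ⟩
    + 2 * rowTotal 3 n - c 3 + c′
      ≡⟨ cong (λ t → + 2 * t - c 3 + c′) (rowTotal-suc 2 n) ⟩
    + 2 * (+ 2 * rowTotal 2 n - c 2) - c 3 + c′
      ≡⟨ cong (λ t → + 2 * (+ 2 * t - c 2) - c 3 + c′) (rowTotal-suc 1 n) ⟩
    + 2 * (+ 2 * (+ 2 * rowTotal 1 n - c 1) - c 2) - c 3 + c′
      ≡⟨ cong (λ t → + 2 * (+ 2 * (+ 2 * t - c 1) - c 2) - c 3 + c′) (rowTotal-suc 0 n) ⟩
    + 2 * (+ 2 * (+ 2 * (+ 2 * rowTotal 0 n - c 0) - c 1) - c 2) - c 3 + c′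
      ≡⟨ expand (rowTotal 0 n) (c 0) (c 1) (c 2) (c 3) c′ ⟩
    + 16 * rowTotal 0 n + (c′ - + 8 * c 0 - + 4 * c 1 - + 2 * c 2 - c 3) ∎
    where
    c′ = rowCoeff 0 (suc n)
    expand : ∀ t c₀ c₁ c₂ c₃ c₄ →
      + 2 * (+ 2 * (+ 2 * (+ 2 * t - c₀) - c₁) - c₂) - c₃ + c₄ ≡
      + 16 * t + (c₄ - + 8 * c₀ - + 4 * c₁ - + 2 * c₂ - c₃)
    expand = ℤ-Ring.solve-∀

  -- The cubic arises from `3 P₄ - 8 P₃ - 4 q₁ p₂ p₃ - 2 q₁ q₂ p₃`, which equals `-6` times it.
  scaled-rowTotal : P₃ x * rowTotal 0 (suc n) ≡
    + 16 * P₃ x * rowTotal 0 n - + 6 * (+ 44 * x * x * x + + 98 * x * x + + 62 * x + + 11) * c 0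
  scaled-rowTotal = begin
    P₃ x * rowTotal 0 (suc n)
      ≡⟨ cong (P₃ x *_) rowTotal-step ⟩
    P₃ x * (+ 16 * t + (c′ - + 8 * c 0 - + 4 * c 1 - + 2 * c 2 - c 3))
      ≡⟨ distribute (P₃ x) t (c 0) (c 1) (c 2) (c 3) c′ ⟩
    + 16 * P₃ x * t + (P₃ x * c′ - + 8 * P₃ x * c 0 - + 4 * (P₃ x * c 1) - + 2 * (P₃ x * c 2) - P₃ x * c 3)
      ≡⟨ cong (_+_ (+ 16 * P₃ x * t)) (cong₂ _-_ (cong₂ (λ a b → a - + 2 * b)
           (cong₂ (λ a b → a - + 8 * P₃ x * c 0 - + 4 * b) scaled-wrap scaled₁) scaled₂) scaled₃) ⟩
    + 16 * P₃ x * t + (+ 4 * P₄ x * c 0 - + 8 * P₃ x * c 0 - + 4 * (q₁ * p₂ * p₃ * c 0)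
                        - + 2 * (q₁ * q₂ * p₃ * c 0) - P₄ x * c 0)
      ≡⟨ collect x t (c 0) ⟩
    + 16 * P₃ x * t - + 6 * (+ 44 * x * x * x + + 98 * x * x + + 62 * x + + 11) * c 0 ∎
    where
    t = rowTotal 0 n
    c′ = rowCoeff 0 (suc n)
    distribute : ∀ p t c₀ c₁ c₂ c₃ c₄ →
      p * (+ 16 * t + (c₄ - + 8 * c₀ - + 4 * c₁ - + 2 * c₂ - c₃)) ≡
      + 16 * p * t + (p * c₄ - + 8 * p * c₀ - + 4 * (p * c₁) - + 2 * (p * c₂) - p * c₃)
    distribute = ℤ-Ring.solve-∀
    collect : ∀ x t c →
      let p₁ = + 3 * x + + 1; p₂ = + 3 * x + + 2; p₃ = + 3 * x + + 3
          q₁ = + 4 * x + + 1; q₂ = + 4 * x + + 2; q₃ = + 4 * x + + 3 in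
      + 16 * (p₁ * p₂ * p₃) * t + (+ 4 * (q₁ * q₂ * q₃) * c - + 8 * (p₁ * p₂ * p₃) * c
        - + 4 * (q₁ * p₂ * p₃ * c) - + 2 * (q₁ * q₂ * p₃ * c) - q₁ * q₂ * q₃ * c) ≡
      + 16 * (p₁ * p₂ * p₃) * t - + 6 * (+ 44 * x * x * x + + 98 * x * x + + 62 * x + + 11) * c
    collect = ℤ-Ring.solve-∀

-- Remainders: increments and size

remainder : ℤ → ℤ → ℤ → ℕ → ℤ
remainder α β γ n = α * rowTotal 0 n + (β + γ * + n) * rowCoeff 0 n

increment : ℤ → ℤ → ℤ → ℤ → ℤ
increment α β γ n =
  + 4 * (β + γ * (n + + 1)) * P₄ n - + 16 * (β + γ * n) * P₃ n
    - + 6 * α * (+ 44 * n * n * n + + 98 * n * n + + 62 * n + + 11)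

-- The multiples of `V n` cancel by `scaled-rowTotal`, leaving a polynomial times `C(4n, n)`, the
-- shape of a term of the series.
remainder-step : ∀ α β γ n → P₃ (+ n) * (remainder α β γ (suc n) - + 16 * remainder α β γ n)
                             ≡ increment α β γ (+ n) * rowCoeff 0 n
remainder-step α β γ n = begin
  P₃ x * (α * t′ + (β + γ * + suc n) * c′ - + 16 * (α * t + (β + γ * x) * c))
    ≡⟨ cong (λ k → P₃ x * (α * t′ + (β + γ * + k) * c′ - + 16 * (α * t + (β + γ * x) * c))) (ℕ.+-comm 1 n) ⟩
  P₃ x * (α * t′ + (β + γ * (x + + 1)) * c′ - + 16 * (α * t + (β + γ * x) * c))
    ≡⟨ distribute (P₃ x) x α β γ t c t′ c′ ⟩
  α * (P₃ x * t′) + (β + γ * (x + + 1)) * (P₃ x * c′) - + 16 * P₃ x * (α * t + (β + γ * x) * c)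
    ≡⟨ cong₂ (λ a b → α * a + (β + γ * (x + + 1)) * b - + 16 * P₃ x * (α * t + (β + γ * x) * c))
         (scaled-rowTotal n) (scaled-wrap n) ⟩
  α * (+ 16 * P₃ x * t - + 6 * s * c) + (β + γ * (x + + 1)) * (+ 4 * P₄ x * c) - + 16 * P₃ x * (α * t + (β + γ * x) * c)
    ≡⟨ collect (P₃ x) (P₄ x) s x α β γ t c ⟩
  increment α β γ x * c ∎
  where
  open ≡-Reasoning
  x = + n
  t = rowTotal 0 n
  c = rowCoeff 0 n
  t′ = rowTotal 0 (suc n)
  c′ = rowCoeff 0 (suc n)
  s = + 44 * x * x * x + + 98 * x * x + + 62 * x + + 11
  distribute : ∀ p x α β γ t c t′ c′ →
    p * (α * t′ + (β + γ * (x + + 1)) * c′ - + 16 * (α * t + (β + γ * x) * c)) ≡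
    α * (p * t′) + (β + γ * (x + + 1)) * (p * c′) - + 16 * p * (α * t + (β + γ * x) * c)
  distribute = ℤ-Ring.solve-∀
  collect : ∀ p q s x α β γ t c →
    α * (+ 16 * p * t - + 6 * s * c) + (β + γ * (x + + 1)) * (+ 4 * q * c) - + 16 * p * (α * t + (β + γ * x) * c) ≡
    (+ 4 * (β + γ * (x + + 1)) * q - + 16 * (β + γ * x) * p - + 6 * α * s) * c
  collect = ℤ-Ring.solve-∀

-- Since `C(4n, n)` is a summand of `V n`, both parts are at most linear multiples of `V n`; the
-- factor `4 + n` is the one occurring in `quarterSum-bound`.
∣remainder∣≤ : ∀ α β γ n → ∣ remainder α β γ n ∣ ℕ.≤ (∣ α ∣ ℕ.+ ∣ β ∣ ℕ.+ ∣ γ ∣) ℕ.* ((4 ℕ.+ n) ℕ.* quarterSum n)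
∣remainder∣≤ α β γ n = begin
  ∣ α * + quarterSum n + (β + γ * + n) * + c ∣
    ≤⟨ ℤ.∣i+j∣≤∣i∣+∣j∣ (α * + quarterSum n) ((β + γ * + n) * + c) ⟩
  ∣ α * + quarterSum n ∣ ℕ.+ ∣ (β + γ * + n) * + c ∣
    ≡⟨ cong₂ ℕ._+_ (ℤ.abs-* α (+ quarterSum n)) (ℤ.abs-* (β + γ * + n) (+ c)) ⟩
  ∣ α ∣ ℕ.* quarterSum n ℕ.+ ∣ β + γ * + n ∣ ℕ.* c
    ≤⟨ ℕ.+-monoʳ-≤ (∣ α ∣ ℕ.* quarterSum n) (ℕ.*-mono-≤ linear (C≤rowSum (4 ℕ.* n) n)) ⟩
  ∣ α ∣ ℕ.* quarterSum n ℕ.+ (∣ β ∣ ℕ.+ ∣ γ ∣ ℕ.* n) ℕ.* quarterSum n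
    ≤⟨ ℕ.m≤m+n (∣ α ∣ ℕ.* quarterSum n ℕ.+ (∣ β ∣ ℕ.+ ∣ γ ∣ ℕ.* n) ℕ.* quarterSum n) slack ⟩
  ∣ α ∣ ℕ.* quarterSum n ℕ.+ (∣ β ∣ ℕ.+ ∣ γ ∣ ℕ.* n) ℕ.* quarterSum n ℕ.+ slack
    ≡⟨ compare (∣ α ∣) (∣ β ∣) (∣ γ ∣) n (quarterSum n) ⟩
  (∣ α ∣ ℕ.+ ∣ β ∣ ℕ.+ ∣ γ ∣) ℕ.* ((4 ℕ.+ n) ℕ.* quarterSum n) ∎
  where
  open ℕ.≤-Reasoning
  c = (4 ℕ.* n) C n
  slack = ((∣ α ∣ ℕ.+ ∣ β ∣) ℕ.* (3 ℕ.+ n) ℕ.+ 4 ℕ.* ∣ γ ∣) ℕ.* quarterSum n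
  linear : ∣ β + γ * + n ∣ ℕ.≤ ∣ β ∣ ℕ.+ ∣ γ ∣ ℕ.* n
  linear = ℕ.≤-trans (ℤ.∣i+j∣≤∣i∣+∣j∣ β (γ * + n)) (ℕ.≤-reflexive (cong (∣ β ∣ ℕ.+_) (ℤ.abs-* γ (+ n))))
  compare : ∀ a b g n v → a ℕ.* v ℕ.+ (b ℕ.+ g ℕ.* n) ℕ.* v ℕ.+ ((a ℕ.+ b) ℕ.* (3 ℕ.+ n) ℕ.+ 4 ℕ.* g) ℕ.* v
                        ≡ (a ℕ.+ b ℕ.+ g) ℕ.* ((4 ℕ.+ n) ℕ.* v)
  compare = ℕ-Ring.solve-∀

abs-^ : ∀ i n → ∣ i ^ n ∣ ≡ ∣ i ∣ ℕ.^ n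
abs-^ i zero    = refl
abs-^ i (suc n) = trans (ℤ.abs-* i (i ^ n)) (cong (∣ i ∣ ℕ.*_) (abs-^ i n))

remainder-bound : ∀ α β γ c .{{_ : ℤ.NonZero c}} n →
  suc n ℕ.* ∣ remainder α β γ n ∣ ℕ.≤ (∣ α ∣ ℕ.+ ∣ β ∣ ℕ.+ ∣ γ ∣) ℕ.* 16 ℕ.* ∣ c * (+ 16) ^ n ∣
remainder-bound α β γ c n = begin
  suc n ℕ.* ∣ remainder α β γ n ∣
    ≤⟨ ℕ.*-mono-≤ (ℕ.m≤n+m (suc n) 3) (∣remainder∣≤ α β γ n) ⟩
  (4 ℕ.+ n) ℕ.* (K ℕ.* ((4 ℕ.+ n) ℕ.* quarterSum n))
    ≡⟨ regroup (4 ℕ.+ n) K (quarterSum n) ⟩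
  K ℕ.* ((4 ℕ.+ n) ℕ.* (4 ℕ.+ n) ℕ.* quarterSum n)
    ≤⟨ ℕ.*-monoʳ-≤ K (quarterSum-bound n) ⟩
  K ℕ.* (16 ℕ.* 16 ℕ.^ n)
    ≡⟨ ℕ.*-assoc K 16 (16 ℕ.^ n) ⟨
  K ℕ.* 16 ℕ.* 16 ℕ.^ n
    ≤⟨ ℕ.*-monoʳ-≤ (K ℕ.* 16) (ℕ.m≤n*m (16 ℕ.^ n) ∣ c ∣) ⟩
  K ℕ.* 16 ℕ.* (∣ c ∣ ℕ.* 16 ℕ.^ n)
    ≡⟨ cong (K ℕ.* 16 ℕ.*_) (trans (ℤ.abs-* c ((+ 16) ^ n)) (cong (∣ c ∣ ℕ.*_) (abs-^ (+ 16) n))) ⟨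
  K ℕ.* 16 ℕ.* ∣ c * (+ 16) ^ n ∣ ∎
  where
  open ℕ.≤-Reasoning
  K = ∣ α ∣ ℕ.+ ∣ β ∣ ℕ.+ ∣ γ ∣
  regroup : ∀ s k v → s ℕ.* (k ℕ.* (s ℕ.* v)) ≡ k ℕ.* (s ℕ.* s ℕ.* v)
  regroup = ℕ-Ring.solve-∀

c*16^n≢0 : ∀ c .{{_ : ℤ.NonZero c}} n → ℤ.NonZero (c * (+ 16) ^ n)
c*16^n≢0 c n = ℤ.i*j≢0 c ((+ 16) ^ n) {{it}} {{subst ℕ.NonZero (sym (abs-^ (+ 16) n)) (ℕ.m^n≢0 16 n)}}

-- Summation by remainders

-- The last hypothesis is `m / d = u (n+1) / (c 16^(n+1)) - u n / (c 16^n)` for the remainder `u`,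
-- cleared of denominators, multiplied by `P₃` and rewritten by `remainder-step`. A series thus
-- needs only its constants, an initial value and an identity for its terms.
hasSum-remainder : ∀ α β γ c .{{_ : ℤ.NonZero c}} (m d : ℕ → ℤ) (d≢0 : ∀ n → ℤ.NonZero (d n)) L →
  (remainder α β γ 0 ÷ (c * + 1)) {{c*16^n≢0 c 0}} ≡ ℚ.- L →
  (∀ n → P₃ (+ n) * (+ 16 * c * (+ 16) ^ n * m n) ≡ d n * (increment α β γ (+ n) * rowCoeff 0 n)) →
  (λ n → (m n ÷ d n) {{d≢0 n}}) HasSum L
hasSum-remainder α β γ c m d d≢0 L g0 increments =
  hasSum-telescope (λ n → (m n ÷ d n) {{d≢0 n}}) L u (λ n → c * (+ 16) ^ n) (c*16^n≢0 c)
    g0 step ((∣ α ∣ ℕ.+ ∣ β ∣ ℕ.+ ∣ γ ∣) ℕ.* 16) (remainder-bound α β γ c)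
  where
  open ≡-Reasoning
  u = remainder α β γ
  difference : ∀ n → + 16 * c * (+ 16) ^ n * m n ≡ d n * (u (suc n) - + 16 * u n)
  difference n = ℤ.*-cancelˡ-≡ (P₃ (+ n)) (+ 16 * c * (+ 16) ^ n * m n) (d n * (u (suc n) - + 16 * u n)) {{P₃≢0 n}} (begin
    P₃ (+ n) * (+ 16 * c * (+ 16) ^ n * m n)         ≡⟨ increments n ⟩
    d n * (increment α β γ (+ n) * rowCoeff 0 n)    ≡⟨ cong (d n *_) (remainder-step α β γ n) ⟨
    d n * (P₃ (+ n) * (u (suc n) - + 16 * u n))      ≡⟨ swap (d n) (P₃ (+ n)) (u (suc n) - + 16 * u n) ⟩
    P₃ (+ n) * (d n * (u (suc n) - + 16 * u n))      ∎)
    where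
    swap : ∀ a b e → a * (b * e) ≡ b * (a * e)
    swap = ℤ-Ring.solve-∀
  cross : ∀ u u′ m d c w → + 16 * c * w * m ≡ d * (u′ - + 16 * u) →
          (u * d + m * (c * w)) * (c * (+ 16 * w)) ≡ u′ * (c * w * d)
  cross u u′ m d c w eq = begin
    (u * d + m * (c * w)) * (c * (+ 16 * w))
      ≡⟨ isolate u m d c w ⟩
    + 16 * u * d * c * w + c * w * (+ 16 * c * w * m)
      ≡⟨ cong (λ e → + 16 * u * d * c * w + c * w * e) eq ⟩
    + 16 * u * d * c * w + c * w * (d * (u′ - + 16 * u))
      ≡⟨ cancel u u′ d c w ⟩
    u′ * (c * w * d) ∎
    where
    isolate : ∀ u m d c w → (u * d + m * (c * w)) * (c * (+ 16 * w)) ≡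
      + 16 * u * d * c * w + c * w * (+ 16 * c * w * m)
    isolate = ℤ-Ring.solve-∀
    cancel : ∀ u u′ d c w → + 16 * u * d * c * w + c * w * (d * (u′ - + 16 * u)) ≡ u′ * (c * w * d)
    cancel = ℤ-Ring.solve-∀
  step : ∀ n → (u n ÷ (c * (+ 16) ^ n)) {{c*16^n≢0 c n}} ℚ.+ (m n ÷ d n) {{d≢0 n}}
             ≡ (u (suc n) ÷ (c * (+ 16) ^ suc n)) {{c*16^n≢0 c (suc n)}}
  step n = ÷-+ (u n) (c * (+ 16) ^ n) (m n) (d n) (u (suc n)) (c * (+ 16) ^ suc n)
    {{c*16^n≢0 c n}} {{d≢0 n}} {{c*16^n≢0 c (suc n)}}
    (cross (u n) (u (suc n)) (m n) (d n) c ((+ 16) ^ n) (difference n))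

-- The three series

series₁ : (λ k → let n = + k in
       ((+ 22 * n ^ 2 + + 17 * n - + 2) * + ((4 ℕ.* k) C k)
         ÷ ((n + + 1) * (+ 16) ^ k)) {{denominator₁≢0 k}})
      HasSum fromℤ (+ 17)
-- The increment must equal `48 (3n+1) (3n+2) (22n²+17n-2)`. The coefficient of `n^4` gives
-- `-176 γ = 9504`; the value at `n = 0` and the initial condition `α + β = -17` then determine `α`
-- and `β`.
series₁ = hasSum-remainder (- (+ 20)) (+ 3) (- (+ 54)) (+ 1)
  (λ k → let n = + k in (+ 22 * n ^ 2 + + 17 * n - + 2) * + ((4 ℕ.* k) C k))
  (λ k → (+ k + + 1) * (+ 16) ^ k) denominator₁≢0 (fromℤ (+ 17)) refl
  λ k → identity (+ k) (rowCoeff 0 k) ((+ 16) ^ k)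
  where
  -- The ring solver does not accept _^_, so n ^ 2 is written in unfolded form.
  identity : ∀ n c w →
    (+ 3 * n + + 1) * (+ 3 * n + + 2) * (+ 3 * n + + 3) *
      (+ 16 * + 1 * w * ((+ 22 * (n * (n * + 1)) + + 17 * n - + 2) * c)) ≡
    (n + + 1) * w *
      ((+ 4 * (+ 3 + - (+ 54) * (n + + 1)) * ((+ 4 * n + + 1) * (+ 4 * n + + 2) * (+ 4 * n + + 3))
        - + 16 * (+ 3 + - (+ 54) * n) * ((+ 3 * n + + 1) * (+ 3 * n + + 2) * (+ 3 * n + + 3))
        - + 6 * - (+ 20) * (+ 44 * n * n * n + + 98 * n * n + + 62 * n + + 11)) * c)
  identity = ℤ-Ring.solve-∀

series₂ : (λ k → let n = + k in
       ((+ 11 * n ^ 2 + + 8 * n + + 1) * + ((4 ℕ.* k) C k)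
         ÷ ((+ 3 * n + + 1) * (+ 3 * n + + 2) * (+ 16) ^ k)) {{denominator₂≢0 k}})
      HasSum fromℤ (+ 1)
-- The increment must be the cubic `48 (n+1) (11n²+8n+1)`, so `γ = 0`. Its leading coefficient gives
-- `2β + 3α = -6`, and the initial value gives `α + β = -1`.
series₂ = hasSum-remainder (- (+ 4)) (+ 3) (+ 0) (+ 1)
  (λ k → let n = + k in (+ 11 * n ^ 2 + + 8 * n + + 1) * + ((4 ℕ.* k) C k))
  (λ k → let n = + k in (+ 3 * n + + 1) * (+ 3 * n + + 2) * (+ 16) ^ k) denominator₂≢0 (fromℤ (+ 1)) refl
  λ k → identity (+ k) (rowCoeff 0 k) ((+ 16) ^ k)
  where
  identity : ∀ n c w →
    (+ 3 * n + + 1) * (+ 3 * n + + 2) * (+ 3 * n + + 3) *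
      (+ 16 * + 1 * w * ((+ 11 * (n * (n * + 1)) + + 8 * n + + 1) * c)) ≡
    (+ 3 * n + + 1) * (+ 3 * n + + 2) * w *
      ((+ 4 * (+ 3 + + 0 * (n + + 1)) * ((+ 4 * n + + 1) * (+ 4 * n + + 2) * (+ 4 * n + + 3))
        - + 16 * (+ 3 + + 0 * n) * ((+ 3 * n + + 1) * (+ 3 * n + + 2) * (+ 3 * n + + 3))
        - + 6 * - (+ 4) * (+ 44 * n * n * n + + 98 * n * n + + 62 * n + + 11)) * c)
  identity = ℤ-Ring.solve-∀

series₃ : (λ k → let n = + k in
       ((+ 22 * n ^ 2 - + 18 * n + + 3) * + ((4 ℕ.* k) C k)
         ÷ ((+ 2 * n - + 1) * (+ 4 * n - + 1) * (+ 4 * n - + 3) * (+ 16) ^ k)) {{denominator₃≢0 k}})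
      HasSum (-1ℤ ÷ + 3)
-- The term at index 0 is `-1`, so the rest must sum to `2/3`.
series₃ = hasSum-suc (λ k → (numerator k ÷ denominator k) {{denominator₃≢0 k}}) (+ 2 ÷ + 3)
  -- The increment must be the quadratic `8c (22n²+26n+7)`. Hence `γ = 0` and `2β + 3α = 0`, and the
  -- value at `n = 0` gives `α = 4c/3`; `c = 3` keeps the constants integral.
  (hasSum-remainder (+ 4) (- (+ 6)) (+ 0) (+ 3)
    (λ k → numerator (suc k)) (λ k → denominator (suc k)) (λ k → denominator₃≢0 (suc k))
    (+ 2 ÷ + 3) refl increments)
  where
  numerator denominator : ℕ → ℤ
  numerator k = let n = + k in (+ 22 * n ^ 2 - + 18 * n + + 3) * + ((4 ℕ.* k) C k)
  denominator k = let n = + k in (+ 2 * n - + 1) * (+ 4 * n - + 1) * (+ 4 * n - + 3) * (+ 16) ^ k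

  commute : ∀ p w m c → p * (+ 16 * + 3 * w * (m * c)) ≡ + 48 * w * m * (p * c)
  commute = ℤ-Ring.solve-∀

  -- At `m = n + 1` the three linear factors of the denominator are `2n+1`, `4n+3` and `4n+1`; twice
  -- their product is `q`.
  identity : ∀ n c w → let m = n + + 1; q = (+ 4 * n + + 1) * (+ 4 * n + + 2) * (+ 4 * n + + 3) in
    + 48 * w * (+ 22 * (m * (m * + 1)) - + 18 * m + + 3) * (+ 4 * q * c) ≡
    (+ 2 * m - + 1) * (+ 4 * m - + 1) * (+ 4 * m - + 3) * (+ 16 * w) *
      ((+ 4 * (- (+ 6) + + 0 * m) * q
        - + 16 * (- (+ 6) + + 0 * n) * ((+ 3 * n + + 1) * (+ 3 * n + + 2) * (+ 3 * n + + 3))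
        - + 6 * + 4 * (+ 44 * n * n * n + + 98 * n * n + + 62 * n + + 11)) * c)
  identity = ℤ-Ring.solve-∀

  increments : ∀ k → P₃ (+ k) * (+ 16 * + 3 * (+ 16) ^ k * numerator (suc k))
                   ≡ denominator (suc k) * (increment (+ 4) (- (+ 6)) (+ 0) (+ k) * rowCoeff 0 k)
  -- The computation is polynomial in `+ k`, so it is done with `+ k + + 1` and then transported to
  -- `+ suc k`.
  increments k = subst
    (λ m → P₃ (+ k) * (+ 16 * + 3 * w * ((+ 22 * m ^ 2 - + 18 * m + + 3) * rowCoeff 0 (suc k)))
         ≡ (+ 2 * m - + 1) * (+ 4 * m - + 1) * (+ 4 * m - + 3) * (+ 16 * w)
             * (increment (+ 4) (- (+ 6)) (+ 0) (+ k) * rowCoeff 0 k))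
    (cong +_ (ℕ.+-comm k 1)) (begin
      P₃ (+ k) * (+ 16 * + 3 * w * (f * rowCoeff 0 (suc k)))
        ≡⟨ commute (P₃ (+ k)) w f (rowCoeff 0 (suc k)) ⟩
      + 48 * w * f * (P₃ (+ k) * rowCoeff 0 (suc k))
        ≡⟨ cong (+ 48 * w * f *_) (scaled-wrap k) ⟩
      + 48 * w * f * (+ 4 * P₄ (+ k) * rowCoeff 0 k)
        ≡⟨ identity (+ k) (rowCoeff 0 k) w ⟩
      (+ 2 * m - + 1) * (+ 4 * m - + 1) * (+ 4 * m - + 3) * (+ 16 * w)
        * (increment (+ 4) (- (+ 6)) (+ 0) (+ k) * rowCoeff 0 k) ∎)
    where
    open ≡-Reasoning
    w = (+ 16) ^ k
    m = + k + + 1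
    f = + 22 * m ^ 2 - + 18 * m + + 3

theorem1p3 :
  ((λ k → let n = + k in
     ((+ 22 * n ^ 2 + + 17 * n - + 2) * + ((4 ℕ.* k) C k)
       ÷ ((n + + 1) * (+ 16) ^ k)) {{denominator₁≢0 k}})
    HasSum fromℤ (+ 17))
  ×
  ((λ k → let n = + k in
     ((+ 11 * n ^ 2 + + 8 * n + + 1) * + ((4 ℕ.* k) C k)
       ÷ ((+ 3 * n + + 1) * (+ 3 * n + + 2) * (+ 16) ^ k)) {{denominator₂≢0 k}})
    HasSum fromℤ (+ 1))
  ×
  ((λ k → let n = + k in
     ((+ 22 * n ^ 2 - + 18 * n + + 3) * + ((4 ℕ.* k) C k)
       ÷ ((+ 2 * n - + 1) * (+ 4 * n - + 1) * (+ 4 * n - + 3) * (+ 16) ^ k)) {{denominator₃≢0 k}})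
    HasSum (-1ℤ ÷ + 3))
theorem1p3 = series₁ , series₂ , series₃
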